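{- Let $G=(V,E,w)$ be an undirected graph with nonnegative edge weights and $n=|V|$, and let $k\in\mathbb{N}$. Then the set of values $\{\mathrm{mincut}_G(K_S): S\subseteq V,\ |S|=k\}$ has size $O_k(n^{k-1})$; consequently the family of $k$-multiway-cut instances has redundancy factor $\Omega_k(n)$. Furthermore, this bound is existentially tight: for all $n$ and $k$ there is a graph $G$ on $n$ vertices for which this set has size $\Omega_k(n^{k-1})$.
   Context: A partition of $V$ is a collection of pairwise disjoint subsets of $V$ whose union is $V$; for a partition $\Pi$ and $v\in V$, $\Pi(v)$ is the part containing $v$. For a partition $\Pi$, $\mathrm{cut}_G(\Pi)=\sum_{uv\in E:\,\Pi(u)\neq\Pi(v)} w(uv)$. A demand graph $D$ is a set of unordered vertex pairs; a partition $\Pi$ agrees with $D$ if $\Pi(u)\ne\Pi(v)$ for every $uv\in D$, and $\mathrm{mincut}_G(D)=\min\{\mathrm{cut}_G(\Pi): \Pi \text{ agrees with } D\}$. For $S\subseteq V$, $K_S$ is the demand graph consisting of all pairs of distinct vertices of $S$ (so $\mathrm{mincut}_G(K_S)$ is the minimum weight of an edge set whose removal leaves no path between any two distinct vertices of $S$). The redundancy factor of a family $\mathcal D$ of demand graphs is $|\mathcal D|$ divided by the number of distinct values in $\{\mathrm{mincut}_G(D):D\in\mathcal D\}$. $O_{k},\Omega_k$ hide factors depending only on $k$.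
   Formalization: The edge weights are taken to be nonnegative rational numbers instead of nonnegative reals; k is at least 1, and the Ω_k bounds are stated for all n above a threshold depending only on k. -}

module Defs where

open import Data.Nat using (ℕ; _≤_; _*_; _^_; _∸_)
open import Data.Nat.Combinatorics using (_C_)
open import Data.Bool using (if_then_else_; _∧_; not)
open import Data.Fin using (Fin; _<?_)
open import Data.Fin.Properties using () renaming (_≟_ to _≟ᶠ_)
open import Data.Fin.Subset using (Subset; _∈_; ∣_∣)
open import Data.List using (List; foldr; map; length)
open import Data.List.Base using (allFin)
open import Data.List.Relation.Unary.Unique.Propositional using (Unique)
open import Data.List.Membership.Propositional renaming (_∈_ to _∈ₗ_)
open import Data.Rational using (ℚ; 0ℚ; _+_) renaming (_≤_ to _≤ℚ_)
open import Data.Product using (Σ; ∃; _×_)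
open import Function.Bundles using (_⇔_)
open import Relation.Nullary using (¬_)
open import Relation.Nullary.Decidable using (⌊_⌋)
open import Relation.Binary.PropositionalEquality using (_≡_; _≢_)

-- An undirected weighted graph on vertex set Fin n is given by a weight
-- function on pairs; weight 0 means "no edge". Loops (w i i) are ignored.
Weights : ℕ → Set
Weights n = Fin n → Fin n → ℚ

ValidGraph : ∀ {n} → Weights n → Set
ValidGraph {n} w = (∀ i j → w i j ≡ w j i) × (∀ i j → 0ℚ ≤ℚ w i j)

-- A partition Π of V = Fin n, given by a labelling of vertices by part
-- names (at most n parts are ever needed, so Fin n labels suffice);
-- Π(u) = Π(v) iff u and v get the same label.
Partition : ℕ → Set
Partition n = Fin n → Fin n

sumFin : ∀ {n} → (Fin n → ℚ) → ℚ
sumFin {n} f = foldr _+_ 0ℚ (map f (allFin n))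

cut : ∀ {n} → Weights n → Partition n → ℚ
cut w Π = sumFin (λ i → sumFin (λ j →
  if ⌊ i <? j ⌋ ∧ not ⌊ Π i ≟ᶠ Π j ⌋ then w i j else 0ℚ))

AgreesK : ∀ {n} → Subset n → Partition n → Set
AgreesK S Π = ∀ u v → u ∈ S → v ∈ S → u ≢ v → Π u ≢ Π v

IsMinCutK : ∀ {n} → Weights n → Subset n → ℚ → Set
IsMinCutK w S c =
  (Σ _ λ Π → AgreesK S Π × cut w Π ≡ c) ×
  (∀ Π → AgreesK S Π → c ≤ℚ cut w Π)

IsKValue : ∀ {n} → Weights n → ℕ → ℚ → Set
IsKValue w k q = Σ _ λ S → ∣ S ∣ ≡ k × IsMinCutK w S q

-- L is an exact duplicate-free enumeration of that set of values
-- (so length L is the size of the set)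
EnumKValues : ∀ {n} → Weights n → ℕ → List ℚ → Set
EnumKValues w k L = Unique L × (∀ q → (q ∈ₗ L) ⇔ IsKValue w k q)

{-# OPTIONS --safe #-}
-- Upper bound.  Put k = j + 1.  For a value q attained by (S, Π), fix s ∈ S and let Q be the set of
-- colours (labels) Π(S - s), so ∣Q∣ = j.  Over F₂, consider the number of facets S′ - s′ of a k-set S′
-- with Π(S′ - s′) = Q.  It is 1 for S′ = S, because Π is injective on S.  It is 0 if Π identifies two
-- elements u, v of S′: the facets S′ - u and S′ - v have the same image, and any other facet contains
-- both u and v, so its image has fewer than j elements.  Since Π disagrees with every S′ of larger
-- value, listing the values in increasing order gives a triangular system of F₂-linear functionals in
-- the C(n, j) indicators of j-sets, hence at most C(n, j) values.
--
-- Tightness.  In the star whose i-th leaf has an edge of weight 2^i, separating the centre and a j-set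
-- T of leaves costs Σ_{i ∈ T} 2^i, and these sums are pairwise distinct.
module Submission where

open import Defs
open import Algebra.Bundles using (CommutativeRing)
import Algebra.Properties.CommutativeSemigroup as CommutativeSemigroupProperties
import Algebra.Properties.Group as GroupProperties
import Algebra.Properties.Semiring.Sum as SemiringSum
open import Data.Bool using (Bool; true; false; _∧_; _xor_; not; if_then_else_)
open import Data.Bool.Properties using (xor-∧-commutativeRing; xor-same; xor-identityʳ; ∧-identityʳ; ∧-zeroʳ; not-¬; if-eta) renaming (_≟_ to _≟ᵇ_)
open import Data.Fin using (Fin; zero; suc; toℕ; punchIn; punchOut; finToFun; funToFin; _<?_)
open import Data.Fin.Properties as Fin using (punchInᵢ≢i; punchIn-injective; punchIn-punchOut; all?; finToFun-funToFin) renaming (_≟_ to _≟ᶠ_)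
open import Data.Fin.Subset using (Subset; inside; outside; _∈_; _∉_; _⊆_; _∪_; _-_; ⁅_⁆; ∣_∣; Nonempty) renaming (⊥ to ∅)
open import Data.Fin.Subset.Properties using (_∈?_; x∈⁅x⁆; x∈⁅y⁆⇒x≡y; ∉⊥; ∪-identityˡ; x∈p∪q⁻; x∈p∪q⁺; p─⊥≡p; p─q⊆p; x∈p∧x≢y⇒x∈p-y; ⊆-antisym; ∣⊥∣≡0)
open import Data.List using (List; []; _∷_; length; map; _++_; foldr; filter; deduplicate; allFin)
open import Data.List.Properties using (length-++; length-map; map-cong; map-tabulate)
open import Data.List.Membership.Propositional using () renaming (_∈_ to _∈ₗ_; _∉_ to _∉ₗ_)
open import Data.List.Membership.Propositional.Properties using (∈-∃++; ∈-++⁺ˡ; ∈-++⁺ʳ; ∈-++⁻; ∈-map⁺; ∈-map⁻; ∈-filter⁺; ∈-allFin; ∈-deduplicate⁺; ∈-deduplicate⁻)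
open import Data.List.Relation.Binary.Permutation.Propositional using (↭-sym; ↭⇒↭ₛ)
open import Data.List.Relation.Binary.Permutation.Propositional.Properties using (All-resp-↭; ↭-length)
import Data.List.Relation.Binary.Permutation.Setoid.Properties as Permutationₛ
open import Data.List.Relation.Unary.All as All using (All; []; _∷_)
open import Data.List.Relation.Unary.All.Properties using (all-filter)
open import Data.List.Relation.Unary.AllPairs as AllPairs using (AllPairs; []; _∷_)
import Data.List.Relation.Unary.AllPairs.Properties as AllPairs
open import Data.List.Relation.Unary.Any using (here; there)
open import Data.List.Relation.Unary.Sorted.TotalOrder.Properties using (Sorted⇒AllPairs)
open import Data.List.Relation.Unary.Unique.Propositional using (Unique)
import Data.List.Relation.Unary.Unique.Propositional.Properties as Unique
open import Data.Nat using (ℕ; zero; suc; _≤_; _<_; _+_; _*_; _^_; _∸_; z≤n; s≤s)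
open import Data.Nat.Properties as ℕ using (module ≤-Reasoning; ≤-refl; ≤-trans; ≤-reflexive; n≤1+n; m≤n⇒m≤1+n; <-irrefl; suc-injective)
open import Data.Nat.Combinatorics using (_C_; nCk+nC[k+1]≡[n+1]C[k+1]; nC1≡n)
open import Data.Nat.Solver using (module +-*-Solver)
open import Data.Product using (Σ; ∃; _×_; _,_; proj₁; proj₂)
open import Data.Rational as ℚ using (ℚ; 0ℚ; 1ℚ) renaming (_≤_ to _≤ℚ_; _<_ to _<ℚ_)
open import Data.Rational.Properties as ℚ using ()
open import Data.Sum using (inj₁; inj₂)
open import Data.Vec using ([]; _∷_; lookup; here; there)
open import Data.Vec.Properties using (≡-dec; ∷-injectiveʳ; []=⇒lookup; lookup⇒[]=)
open import Function using (_∘_; id)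
open import Function.Bundles using (mk⇔; Equivalence)
open import Relation.Binary.Bundles using (DecTotalOrder)
open import Relation.Binary.PropositionalEquality
open import Relation.Nullary using (Dec; yes; no; ¬_; contradiction)
open import Relation.Nullary.Decidable using (⌊_⌋; isYes≗does; dec-true; dec-false; ¬?; _→-dec_)
open import Data.List.Extrema (DecTotalOrder.totalOrder ℚ.≤-decTotalOrder) using (argmin; argmin-all; f[argmin]≤f[xs])
open import Data.List.Relation.Unary.Unique.DecPropositional.Properties ℚ._≟_ using (deduplicate-!)
open import Data.List.Sort ℚ.≤-decTotalOrder using (sort; sort-↭; sort-↗)

open SemiringSum (CommutativeRing.semiring xor-∧-commutativeRing)
  using (sum-remove; sum-cong-≗; ∑-distrib-+; *-distribˡ-sum; sum-replicate-zero)
  renaming (sum to ⨁)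
open GroupProperties ℚ.+-0-group using () renaming (∙-cancelˡ to +ℚ-cancelˡ)

private
  variable
    m n : ℕ

-- Sums over F₂

⨁-zero : (f : Fin n → Bool) → (∀ i → f i ≡ false) → ⨁ f ≡ false
⨁-zero {n} f f≡0 = trans (sum-cong-≗ f≡0) (sum-replicate-zero n)

⨁-single : (f : Fin n → Bool) (u : Fin n) → (∀ i → i ≢ u → f i ≡ false) → ⨁ f ≡ f u
⨁-single {suc n} f u rest = begin
  ⨁ f                            ≡⟨ sum-remove {i = u} f ⟩
  f u xor ⨁ (f ∘ punchIn u)      ≡⟨ cong (f u xor_) (⨁-zero _ (λ i → rest _ (punchInᵢ≢i u i))) ⟩
  f u xor false                  ≡⟨ xor-identityʳ (f u) ⟩
  f u                            ∎
  where open ≡-Reasoning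

-- The two terms outside the vanishing range are equal, so they cancel in characteristic 2.
⨁-pair : (f : Fin n → Bool) {u v : Fin n} → u ≢ v → f u ≡ f v →
         (∀ i → i ≢ u → i ≢ v → f i ≡ false) → ⨁ f ≡ false
⨁-pair {suc n} f {u} {v} u≢v fu≡fv rest = begin
  ⨁ f                                  ≡⟨ sum-remove {i = u} f ⟩
  f u xor ⨁ (f ∘ punchIn u)            ≡⟨ cong (f u xor_) (⨁-single _ v′ rest′) ⟩
  f u xor f (punchIn u v′)             ≡⟨ cong (λ x → f u xor f x) (punchIn-punchOut u≢v) ⟩
  f u xor f v                          ≡⟨ cong (f u xor_) fu≡fv ⟨
  f u xor f u                          ≡⟨ xor-same (f u) ⟩
  false                                ∎
  where
  open ≡-Reasoning
  v′ : Fin n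
  v′ = punchOut u≢v
  rest′ : ∀ i → i ≢ v′ → f (punchIn u i) ≡ false
  rest′ i i≢v′ = rest _ (punchInᵢ≢i u i) λ eq → i≢v′
    (punchIn-injective u i v′ (trans eq (sym (punchIn-punchOut u≢v))))

⨁-true : (f : Fin n → Bool) → ⨁ f ≡ true → ∃ λ i → f i ≡ true
⨁-true {suc n} f eq with f zero in f0
... | true  = zero , f0
... | false with i , fi ← ⨁-true (f ∘ suc) eq = suc i , fi

-- The coboundary over F₂

-- This is the simplicial coboundary mod 2: `b` is a cochain, summed over the facets of `S`.
δ : (Subset n → Bool) → Subset n → Bool
δ b S = ⨁ λ s → lookup S s ∧ b (S - s)

-- Linearity with `xor` as addition and `∧` as multiplication, in the shape of a single row
-- operation.
δ-linear : (b b′ : Subset n → Bool) (c : Bool) (S : Subset n) →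
           δ (λ T → b T xor (c ∧ b′ T)) S ≡ δ b S xor (c ∧ δ b′ S)
δ-linear b b′ c S = begin
  ⨁ (λ s → lookup S s ∧ (b (S - s) xor (c ∧ b′ (S - s))))
    ≡⟨ sum-cong-≗ (λ s → distrib (lookup S s) (b (S - s)) c (b′ (S - s))) ⟩
  ⨁ (λ s → (lookup S s ∧ b (S - s)) xor (c ∧ (lookup S s ∧ b′ (S - s))))
    ≡⟨ ∑-distrib-+ (λ s → lookup S s ∧ b (S - s)) (λ s → c ∧ (lookup S s ∧ b′ (S - s))) ⟩
  δ b S xor ⨁ (λ s → c ∧ (lookup S s ∧ b′ (S - s)))
    ≡⟨ cong (δ b S xor_) (*-distribˡ-sum c (λ s → lookup S s ∧ b′ (S - s))) ⟨
  δ b S xor (c ∧ δ b′ S) ∎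
  where
  open ≡-Reasoning
  distrib : ∀ l x c y → l ∧ (x xor (c ∧ y)) ≡ (l ∧ x) xor (c ∧ (l ∧ y))
  distrib true  x c y = refl
  distrib false x c y = sym (∧-zeroʳ c)

-- Cardinalities of subsets and of their images

x∉p-x : (p : Subset n) (x : Fin n) → x ∉ p - x
x∉p-x (s ∷ p) (suc x) (there x∈) = x∉p-x p x x∈

∣p-x∣ : {p : Subset n} {x : Fin n} → x ∈ p → suc ∣ p - x ∣ ≡ ∣ p ∣
∣p-x∣ {p = inside  ∷ p} here       = cong (suc ∘ ∣_∣) (p─⊥≡p p)
∣p-x∣ {p = inside  ∷ p} (there x∈) = cong suc (∣p-x∣ x∈)
∣p-x∣ {p = outside ∷ p} (there x∈) = ∣p-x∣ x∈

nonempty : (p : Subset n) {j : ℕ} → ∣ p ∣ ≡ suc j → Nonempty p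
nonempty (inside  ∷ p) eq = zero , here
nonempty (outside ∷ p) eq with x , x∈p ← nonempty p eq = suc x , there x∈p

∣⁅x⁆∪p∣≤ : (x : Fin n) (p : Subset n) → ∣ ⁅ x ⁆ ∪ p ∣ ≤ suc ∣ p ∣
∣⁅x⁆∪p∣≤ zero    (inside  ∷ p) = s≤s (m≤n⇒m≤1+n (≤-reflexive (cong ∣_∣ (∪-identityˡ p))))
∣⁅x⁆∪p∣≤ zero    (outside ∷ p) = s≤s (≤-reflexive (cong ∣_∣ (∪-identityˡ p)))
∣⁅x⁆∪p∣≤ (suc x) (inside  ∷ p) = s≤s (∣⁅x⁆∪p∣≤ x p)
∣⁅x⁆∪p∣≤ (suc x) (outside ∷ p) = ∣⁅x⁆∪p∣≤ x p

∣⁅x⁆∪p∣ : (x : Fin n) (p : Subset n) → x ∉ p → ∣ ⁅ x ⁆ ∪ p ∣ ≡ suc ∣ p ∣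
∣⁅x⁆∪p∣ zero    (inside  ∷ p) x∉p = contradiction here x∉p
∣⁅x⁆∪p∣ zero    (outside ∷ p) x∉p = cong (suc ∘ ∣_∣) (∪-identityˡ p)
∣⁅x⁆∪p∣ (suc x) (inside  ∷ p) x∉p = cong suc (∣⁅x⁆∪p∣ x p (x∉p ∘ there))
∣⁅x⁆∪p∣ (suc x) (outside ∷ p) x∉p = ∣⁅x⁆∪p∣ x p (x∉p ∘ there)

image : (Fin m → Fin n) → Subset m → Subset n
image f []            = ∅
image f (inside  ∷ S) = ⁅ f zero ⁆ ∪ image (f ∘ suc) S
image f (outside ∷ S) = image (f ∘ suc) S

∈-image⁺ : (f : Fin m → Fin n) {S : Subset m} {x : Fin m} → x ∈ S → f x ∈ image f S
∈-image⁺ f {inside  ∷ S} here       = x∈p∪q⁺ (inj₁ (x∈⁅x⁆ _))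
∈-image⁺ f {inside  ∷ S} (there x∈) = x∈p∪q⁺ (inj₂ (∈-image⁺ (f ∘ suc) x∈))
∈-image⁺ f {outside ∷ S} (there x∈) = ∈-image⁺ (f ∘ suc) x∈

∈-image⁻ : (f : Fin m → Fin n) (S : Subset m) {y : Fin n} → y ∈ image f S → ∃ λ x → x ∈ S × f x ≡ y
∈-image⁻ f []            y∈ = contradiction y∈ ∉⊥
∈-image⁻ f (outside ∷ S) y∈ with x , x∈ , eq ← ∈-image⁻ (f ∘ suc) S y∈ = suc x , there x∈ , eq
∈-image⁻ f (inside  ∷ S) y∈ with x∈p∪q⁻ ⁅ f zero ⁆ (image (f ∘ suc) S) y∈
... | inj₁ y∈⁅f0⁆ = zero , here , sym (x∈⁅y⁆⇒x≡y _ y∈⁅f0⁆)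
... | inj₂ y∈rest with x , x∈ , eq ← ∈-image⁻ (f ∘ suc) S y∈rest = suc x , there x∈ , eq

∣image∣≤ : (f : Fin m → Fin n) (S : Subset m) → ∣ image f S ∣ ≤ ∣ S ∣
∣image∣≤ {n = n} f []            = ≤-reflexive (∣⊥∣≡0 n)
∣image∣≤         f (outside ∷ S) = ∣image∣≤ (f ∘ suc) S
∣image∣≤         f (inside  ∷ S) = ≤-trans (∣⁅x⁆∪p∣≤ (f zero) _) (s≤s (∣image∣≤ (f ∘ suc) S))

InjectiveOn : (Fin m → Fin n) → Subset m → Set
InjectiveOn f S = ∀ {u v} → u ∈ S → v ∈ S → f u ≡ f v → u ≡ v

∣image∣-injective : (f : Fin m → Fin n) (S : Subset m) → InjectiveOn f S → ∣ image f S ∣ ≡ ∣ S ∣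
∣image∣-injective {n = n} f []            inj = ∣⊥∣≡0 n
∣image∣-injective         f (outside ∷ S) inj =
  ∣image∣-injective (f ∘ suc) S λ u∈ v∈ eq → Fin.suc-injective (inj (there u∈) (there v∈) eq)
∣image∣-injective         f (inside  ∷ S) inj = trans
  (∣⁅x⁆∪p∣ (f zero) _ f0∉)
  (cong suc (∣image∣-injective (f ∘ suc) S λ u∈ v∈ eq → Fin.suc-injective (inj (there u∈) (there v∈) eq)))
  where
  f0∉ : f zero ∉ image (f ∘ suc) S
  f0∉ f0∈ with x , x∈ , eq ← ∈-image⁻ (f ∘ suc) S f0∈ with () ← inj (there x∈) here eq

-- Nothing is lost with `u`, since `v` stays and carries the same label.
image-remove : (f : Fin m → Fin n) {S : Subset m} {u v : Fin m} →
               v ∈ S → u ≢ v → f u ≡ f v → image f (S - u) ≡ image f S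
image-remove f {S} {u} {v} v∈S u≢v fu≡fv = ⊆-antisym
  (λ y∈ → let x , x∈ , eq = ∈-image⁻ f (S - u) y∈
          in subst (_∈ image f S) eq (∈-image⁺ f (p─q⊆p S ⁅ u ⁆ x∈)))
  restore
  where
  restore : image f S ⊆ image f (S - u)
  restore y∈ with x , x∈ , refl ← ∈-image⁻ f S y∈ with x ≟ᶠ u
  ... | yes refl = subst (_∈ image f (S - u)) (sym fu≡fv) (∈-image⁺ f (x∈p∧x≢y⇒x∈p-y v∈S (u≢v ∘ sym)))
  ... | no  x≢u  = ∈-image⁺ f (x∈p∧x≢y⇒x∈p-y x∈ x≢u)

∣image∣<-collision : (f : Fin m → Fin n) {S : Subset m} {u v : Fin m} →
                     u ∈ S → v ∈ S → u ≢ v → f u ≡ f v → ∣ image f S ∣ < ∣ S ∣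
∣image∣<-collision f {S} {u} u∈S v∈S u≢v fu≡fv = subst₂ _≤_
  (cong (suc ∘ ∣_∣) (image-remove f v∈S u≢v fu≡fv)) (∣p-x∣ u∈S) (s≤s (∣image∣≤ f (S - u)))

-- Facets with a prescribed image

_≟ˢ_ : (p q : Subset n) → Dec (p ≡ q)
_≟ˢ_ = ≡-dec _≟ᵇ_

hasImage : (Fin m → Fin n) → Subset n → Subset m → Bool
hasImage f Q T = ⌊ image f T ≟ˢ Q ⌋

hasImage-true : (f : Fin m → Fin n) {Q : Subset n} {T : Subset m} → image f T ≡ Q → hasImage f Q T ≡ true
hasImage-true f {Q} {T} eq = trans (isYes≗does (image f T ≟ˢ Q)) (dec-true (image f T ≟ˢ Q) eq)

hasImage-false : (f : Fin m → Fin n) {Q : Subset n} {T : Subset m} → image f T ≢ Q → hasImage f Q T ≡ false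
hasImage-false f {Q} {T} neq = trans (isYes≗does (image f T ≟ˢ Q)) (dec-false (image f T ≟ˢ Q) neq)

∧-false : (l : Bool) {x : Bool} → (l ≡ true → x ≡ false) → l ∧ x ≡ false
∧-false true  h = h refl
∧-false false h = refl

-- Only the facet at `s` contributes: for another `i` in `S`, the label `f i` occurs on `S - s` but,
-- by injectivity, not on `S - i`.
δ-injective : (f : Fin m → Fin n) (S : Subset m) (s : Fin m) → InjectiveOn f S → s ∈ S →
              δ (hasImage f (image f (S - s))) S ≡ true
δ-injective f S s inj s∈S = trans (⨁-single _ s others)
  (cong₂ _∧_ ([]=⇒lookup s∈S) (hasImage-true f {T = S - s} refl))
  where
  others : ∀ i → i ≢ s → lookup S i ∧ hasImage f (image f (S - s)) (S - i) ≡ false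
  others i i≢s = ∧-false (lookup S i) λ i∈ → hasImage-false f {T = S - i} λ eq →
    let i∈S = lookup⇒[]= i S i∈
        x , x∈ , fx≡fi = ∈-image⁻ f (S - i) (subst (f i ∈_) (sym eq) (∈-image⁺ f (x∈p∧x≢y⇒x∈p-y i∈S i≢s)))
    in x∉p-x S i (subst (_∈ S - i) (inj (p─q⊆p S ⁅ i ⁆ x∈) i∈S fx≡fi) x∈)

δ-collision : (f : Fin m → Fin n) {Q : Subset n} {S : Subset m} {u v : Fin m} → ∣ S ∣ ≡ suc ∣ Q ∣ →
              u ∈ S → v ∈ S → u ≢ v → f u ≡ f v → δ (hasImage f Q) S ≡ false
δ-collision f {Q} {S} {u} {v} size u∈S v∈S u≢v fu≡fv = ⨁-pair _ u≢v
  -- The facets at `u` and `v` both have the image of all of `S`, so they pass or fail the test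
  -- together.
  (cong₂ _∧_ (trans ([]=⇒lookup u∈S) (sym ([]=⇒lookup v∈S)))
    (cong (λ I → ⌊ I ≟ˢ Q ⌋)
      (trans (image-remove f v∈S u≢v fu≡fv) (sym (image-remove f u∈S (u≢v ∘ sym) (sym fu≡fv))))))
  λ i i≢u i≢v → ∧-false (lookup S i) λ i∈ → hasImage-false f {T = S - i} λ eq →
    -- The facet `S - i` has `∣ Q ∣` elements and still contains the collision, so its image is too
    -- small to be `Q`.
    <-irrefl (cong ∣_∣ eq) (≤-trans
      (∣image∣<-collision f (x∈p∧x≢y⇒x∈p-y u∈S (i≢u ∘ sym)) (x∈p∧x≢y⇒x∈p-y v∈S (i≢v ∘ sym)) u≢v fu≡fv)
      (≤-reflexive (suc-injective (trans (∣p-x∣ (lookup⇒[]= i S i∈)) size))))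

-- Gaussian elimination of a triangular system

δ-true : {b : Subset n → Bool} (S : Subset n) → δ b S ≡ true → ∃ λ s → s ∈ S × b (S - s) ≡ true
δ-true {b = b} S eq with s , both ← ⨁-true (λ s → lookup S s ∧ b (S - s)) eq with lookup S s in s∈
... | true = s , lookup⇒[]= s S s∈ , both

-- Adds a multiple of b₀ to b so that the result vanishes at T₀ (given b₀ T₀ = 1).
pivot : (Subset n → Bool) → Subset n → (Subset n → Bool) → Subset n → Bool
pivot b₀ T₀ b T = b T xor (b T₀ ∧ b₀ T)

pivot-vanish : (b₀ : Subset n → Bool) {T₀ : Subset n} (b : Subset n → Bool) →
               b₀ T₀ ≡ true → pivot b₀ T₀ b T₀ ≡ false
pivot-vanish b₀ {T₀} b b₀T₀ = trans (cong (λ c → b T₀ xor (b T₀ ∧ c)) b₀T₀)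
  (trans (cong (b T₀ xor_) (∧-identityʳ _)) (xor-same (b T₀)))

pivot-zero : (b₀ : Subset n → Bool) (T₀ : Subset n) (b : Subset n → Bool) {T : Subset n} →
             b₀ T ≡ false → b T ≡ false → pivot b₀ T₀ b T ≡ false
pivot-zero b₀ T₀ b b₀T bT = cong₂ _xor_ bT (trans (cong (b T₀ ∧_) b₀T) (∧-zeroʳ _))

-- By linearity the row operation changes the value at `S` by a multiple of `δ b₀ S`. Hence clearing
-- with an earlier functional leaves the later rows of the triangular system unchanged.
δ-pivot : (b₀ : Subset n → Bool) (T₀ : Subset n) (b : Subset n → Bool) {S : Subset n} →
          δ b₀ S ≡ false → δ (pivot b₀ T₀ b) S ≡ δ b S
δ-pivot b₀ T₀ b {S} δb₀ = trans (δ-linear b b₀ (b T₀) S)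
  (trans (cong (λ y → δ b S xor (b T₀ ∧ y)) δb₀)
    (trans (cong (δ b S xor_) (∧-zeroʳ (b T₀))) (xor-identityʳ _)))

module _ {A : Set} (S : A → Subset n) {j : ℕ} (size : ∀ a → ∣ S a ∣ ≡ suc j) where

  δ-pivot-pairs : (b₀ : Subset n → Bool) (T₀ : Subset n) (b : A → Subset n → Bool) {as : List A} →
    All (λ a → δ b₀ (S a) ≡ false) as →
    AllPairs (λ a a′ → δ (b a) (S a′) ≡ false) as →
    AllPairs (λ a a′ → δ (pivot b₀ T₀ (b a)) (S a′) ≡ false) as
  δ-pivot-pairs b₀ T₀ b []       []       = []
  δ-pivot-pairs b₀ T₀ b (z ∷ zs) (p ∷ ps) =
    All.zipWith (λ (z , d) → trans (δ-pivot b₀ T₀ (b _) z) d) (zs , p) ∷ δ-pivot-pairs b₀ T₀ b zs ps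

  -- Gaussian elimination: each functional b a is nonzero at some facet T of S a; clearing T from the
  -- later functionals makes their facets avoid T, which the last component records.
  eliminate : (b : A → Subset n → Bool) (as : List A) →
    All (λ a → δ (b a) (S a) ≡ true) as →
    AllPairs (λ a a′ → δ (b a) (S a′) ≡ false) as →
    Σ (List (Subset n)) λ Ts → Unique Ts × All (λ T → ∣ T ∣ ≡ j) Ts × length Ts ≡ length as ×
      (∀ T → All (λ a → b a T ≡ false) as → T ∉ₗ Ts)
  eliminate b []       _              _              = [] , [] , [] , refl , λ _ _ ()
  eliminate b (a ∷ as) (diag ∷ diags) (zeros ∷ uppers)
    with s , s∈S , bT₀ ← δ-true {b = b a} (S a) diag
    with Ts , unique , sizes , len , avoid ← eliminate
           (λ a′ → pivot (b a) (S a - s) (b a′)) as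
           (All.zipWith (λ (z , d) → trans (δ-pivot (b a) _ (b _) z) d) (zeros , diags))
           (δ-pivot-pairs (b a) _ b zeros uppers)
    = (S a - s) ∷ Ts
    , All.tabulate (λ T∈ → λ { refl → avoid (S a - s) (All.tabulate λ _ → pivot-vanish (b a) (b _) bT₀) T∈ }) ∷ unique
    , suc-injective (trans (∣p-x∣ s∈S) (size a)) ∷ sizes
    , cong suc len
    -- A set killed by all functionals cannot be the pivot facet, where `b a` is true, and it is
    -- still killed by the pivoted functionals, so the recursive claim covers the tail.
    , λ { _ (bT ∷ _)  (here refl) → not-¬ bT₀ bT
        ; T (bT ∷ bTs) (there T∈) → avoid T (All.map (pivot-zero (b a) _ (b _) bT) bTs) T∈ }

-- Counting subsets of a given size

-- Pigeonhole: one occurrence of the head is deleted from `ys`, and the tail survives the deletion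
-- because it does not repeat the head.
Unique-⊆-length : ∀ {a} {A : Set a} {xs ys : List A} → Unique xs → (∀ {x} → x ∈ₗ xs → x ∈ₗ ys) → length xs ≤ length ys
Unique-⊆-length {xs = []}     _          _   = z≤n
Unique-⊆-length {xs = x ∷ xs} (x∉ ∷ xs!) sub with ps , qs , refl ← ∈-∃++ (sub (here refl)) =
  subst (suc (length xs) ≤_) (sym len) (s≤s (Unique-⊆-length xs! sub′))
  where
  len : length (ps ++ x ∷ qs) ≡ suc (length (ps ++ qs))
  len = trans (length-++ ps) (trans (ℕ.+-suc _ _) (cong suc (sym (length-++ ps))))
  sub′ : ∀ {y} → y ∈ₗ xs → y ∈ₗ ps ++ qs
  sub′ y∈ with ∈-++⁻ ps (sub (there y∈))
  ... | inj₁ y∈ps         = ∈-++⁺ˡ y∈ps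
  ... | inj₂ (here refl)  = contradiction refl (All.lookup x∉ y∈)
  ... | inj₂ (there y∈qs) = ∈-++⁺ʳ ps y∈qs

-- The recursion mirrors Pascal's rule, which then gives the length.
subsetsOfSize : ∀ n → ℕ → List (Subset n)
subsetsOfSize n       zero    = ∅ ∷ []
subsetsOfSize zero    (suc j) = []
subsetsOfSize (suc n) (suc j) = map (inside ∷_) (subsetsOfSize n j) ++ map (outside ∷_) (subsetsOfSize n (suc j))

length-subsetsOfSize : ∀ n j → length (subsetsOfSize n j) ≡ n C j
length-subsetsOfSize n       zero    = refl
length-subsetsOfSize zero    (suc j) = refl
length-subsetsOfSize (suc n) (suc j) = begin
  length (map (inside ∷_) (subsetsOfSize n j) ++ map (outside ∷_) (subsetsOfSize n (suc j)))
    ≡⟨ length-++ (map (inside ∷_) (subsetsOfSize n j)) ⟩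
  length (map (inside ∷_) (subsetsOfSize n j)) + length (map (outside ∷_) (subsetsOfSize n (suc j)))
    ≡⟨ cong₂ _+_ (trans (length-map _ (subsetsOfSize n j)) (length-subsetsOfSize n j))
                 (trans (length-map _ (subsetsOfSize n (suc j))) (length-subsetsOfSize n (suc j))) ⟩
  n C j + n C suc j
    ≡⟨ nCk+nC[k+1]≡[n+1]C[k+1] n j ⟩
  suc n C suc j ∎
  where open ≡-Reasoning

∣p∣≡0⇒p≡∅ : (p : Subset n) → ∣ p ∣ ≡ 0 → p ≡ ∅
∣p∣≡0⇒p≡∅ []            _  = refl
∣p∣≡0⇒p≡∅ (outside ∷ p) eq = cong (outside ∷_) (∣p∣≡0⇒p≡∅ p eq)

∈-subsetsOfSize⁺ : ∀ j {S : Subset n} → ∣ S ∣ ≡ j → S ∈ₗ subsetsOfSize n j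
∈-subsetsOfSize⁺         zero    {S}           eq = here (∣p∣≡0⇒p≡∅ S eq)
∈-subsetsOfSize⁺         (suc j) {inside  ∷ S} eq = ∈-++⁺ˡ (∈-map⁺ (inside ∷_) (∈-subsetsOfSize⁺ j (suc-injective eq)))
∈-subsetsOfSize⁺ {suc n} (suc j) {outside ∷ S} eq =
  ∈-++⁺ʳ (map (inside ∷_) (subsetsOfSize n j)) (∈-map⁺ (outside ∷_) (∈-subsetsOfSize⁺ (suc j) eq))

∈-subsetsOfSize⁻ : ∀ j {S : Subset n} → S ∈ₗ subsetsOfSize n j → ∣ S ∣ ≡ j
∈-subsetsOfSize⁻ {n}     zero    (here refl) = ∣⊥∣≡0 n
∈-subsetsOfSize⁻ {suc n} (suc j) S∈ with ∈-++⁻ (map (inside ∷_) (subsetsOfSize n j)) S∈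
... | inj₁ S∈ˡ with T , T∈ , refl ← ∈-map⁻ (inside ∷_) S∈ˡ = cong suc (∈-subsetsOfSize⁻ j T∈)
... | inj₂ S∈ʳ with T , T∈ , refl ← ∈-map⁻ (outside ∷_) S∈ʳ = ∈-subsetsOfSize⁻ (suc j) T∈

subsetsOfSize-unique : ∀ n j → Unique (subsetsOfSize n j)
subsetsOfSize-unique n       zero    = [] ∷ []
subsetsOfSize-unique zero    (suc j) = []
subsetsOfSize-unique (suc n) (suc j) = Unique.++⁺
  (Unique.map⁺ ∷-injectiveʳ (subsetsOfSize-unique n j))
  (Unique.map⁺ ∷-injectiveʳ (subsetsOfSize-unique n (suc j)))
  λ (S∈ˡ , S∈ʳ) → disjoint (∈-map⁻ (inside ∷_) S∈ˡ) (∈-map⁻ (outside ∷_) S∈ʳ)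
  where
  disjoint : ∀ {S} {X Y : Subset n → Set} → (∃ λ T → X T × S ≡ inside ∷ T) → ¬ (∃ λ T → Y T × S ≡ outside ∷ T)
  disjoint (_ , _ , refl) (_ , _ , ())

-- Upper bound on the number of values

AgreesK⇒InjectiveOn : {S : Subset n} {Π : Partition n} → AgreesK S Π → InjectiveOn Π S
AgreesK⇒InjectiveOn agrees {u} {v} u∈S v∈S eq with u ≟ᶠ v
... | yes u≡v = u≡v
... | no  u≢v = contradiction eq (agrees u v u∈S v∈S u≢v)

-- Carries the strict order of the sorted values over to the list of values bundled with their
-- witnesses.
map-proj₁-toList : ∀ {a p} {A : Set a} {P : A → Set p} {xs : List A} (pxs : All P xs) → map proj₁ (All.toList pxs) ≡ xs
map-proj₁-toList []         = refl
map-proj₁-toList (px ∷ pxs) = cong (_ ∷_) (map-proj₁-toList pxs)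

module _ (w : Weights n) (j : ℕ) where

  -- Bundling a value with its evidence fixes one terminal set and one optimal partition for it.
  Value : Set
  Value = Σ ℚ (IsKValue w (suc j))

  terminals : Value → Subset n
  terminals (_ , S , _) = S

  partition : Value → Partition n
  partition (_ , _ , _ , (Π , _) , _) = Π

  terminals-size : ∀ a → ∣ terminals a ∣ ≡ suc j
  terminals-size (_ , _ , size , _) = size

  agrees : ∀ a → AgreesK (terminals a) (partition a)
  agrees (_ , _ , _ , (_ , ag , _) , _) = ag

  pivotTerminal : ∀ a → ∃ λ s → s ∈ terminals a
  pivotTerminal a = nonempty (terminals a) (terminals-size a)

  colours : Value → Subset n
  colours a = image (partition a) (terminals a - proj₁ (pivotTerminal a))

  ∣colours∣ : ∀ a → ∣ colours a ∣ ≡ j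
  ∣colours∣ a = trans
    (∣image∣-injective (partition a) (terminals a - s) λ u∈ v∈ →
      AgreesK⇒InjectiveOn (agrees a) (p─q⊆p _ _ u∈) (p─q⊆p _ _ v∈))
    (suc-injective (trans (∣p-x∣ s∈) (terminals-size a)))
    where
    s = proj₁ (pivotTerminal a)
    s∈ = proj₂ (pivotTerminal a)

  test : Value → Subset n → Bool
  test a = hasImage (partition a) (colours a)

  test-self : ∀ a → δ (test a) (terminals a) ≡ true
  test-self a = δ-injective (partition a) (terminals a) _ (AgreesK⇒InjectiveOn (agrees a)) (proj₂ (pivotTerminal a))

  -- If the sum were odd, `δ-collision` would rule out any two terminals of `a′` with the same
  -- label. The partition of `a` would then agree with these terminals while its cut is below their
  -- minimum.
  test-larger : ∀ {a a′} → proj₁ a <ℚ proj₁ a′ → δ (test a) (terminals a′) ≡ false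
  test-larger {a@(_ , _ , _ , (Π , _ , refl) , _)} {a′@(_ , _ , _ , _ , minimal)} q<q′
    with δ (test a) (terminals a′) in eq
  ... | false = refl
  ... | true  = contradiction (ℚ.<-≤-trans q<q′ (minimal Π λ u v u∈ v∈ u≢v Πu≡Πv →
    not-¬ eq (δ-collision Π (trans (terminals-size a′) (cong suc (sym (∣colours∣ a)))) u∈ v∈ u≢v Πu≡Πv))) (ℚ.<-irrefl refl)

  values-bound : {L : List ℚ} → Unique L → All (IsKValue w (suc j)) L → length L ≤ n C j
  values-bound {L} L! vals = subst₂ _≤_ len (length-subsetsOfSize n j)
    (Unique-⊆-length Ts! (∈-subsetsOfSize⁺ j ∘ All.lookup sizes))
    where
    -- Sorting puts each value before the larger ones, which is the order in which the system is
    -- triangular.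
    vals′ : All (IsKValue w (suc j)) (sort L)
    vals′ = All-resp-↭ (↭-sym (sort-↭ L)) vals

    as : List Value
    as = All.toList vals′

    -- Sortedness gives the weak order; the absence of duplicates makes it strict.
    increasing : AllPairs _<ℚ_ (sort L)
    increasing = AllPairs.zipWith (λ (p≤q , p≢q) → ℚ.≰⇒> λ q≤p → p≢q (ℚ.≤-antisym p≤q q≤p))
      ( Sorted⇒AllPairs (DecTotalOrder.totalOrder ℚ.≤-decTotalOrder) (sort-↗ L)
      , Permutationₛ.Unique-resp-↭ (setoid ℚ) (↭⇒↭ₛ (↭-sym (sort-↭ L))) L!)

    elimination = eliminate terminals terminals-size test as
      (All.tabulate λ {a} _ → test-self a)
      (AllPairs.map (λ {a} {a′} → test-larger {a} {a′})
        (AllPairs.map⁻ (subst (AllPairs _<ℚ_) (sym (map-proj₁-toList vals′)) increasing)))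

    Ts = proj₁ elimination
    Ts! = proj₁ (proj₂ elimination)
    sizes = proj₁ (proj₂ (proj₂ elimination))

    len : length Ts ≡ length L
    len = trans (proj₁ (proj₂ (proj₂ (proj₂ elimination))))
      (trans (sym (length-map proj₁ as)) (trans (cong length (map-proj₁-toList vals′)) (↭-length (sort-↭ L))))

-- Existence of minimum cuts and enumeration of the values

sumFin-cong : {f g : Fin n → ℚ} → (∀ i → f i ≡ g i) → sumFin f ≡ sumFin g
sumFin-cong {n} f≗g = cong (foldr ℚ._+_ 0ℚ) (map-cong f≗g (allFin n))

-- Used for a partition decoded from its code, which equals the original pointwise.
cut-cong : (w : Weights n) {Π Π′ : Partition n} → (∀ i → Π i ≡ Π′ i) → cut w Π ≡ cut w Π′
cut-cong w Π≗Π′ = sumFin-cong λ i → sumFin-cong λ j →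
  cong₂ (λ x y → if ⌊ i <? j ⌋ ∧ not ⌊ x ≟ᶠ y ⌋ then w i j else 0ℚ) (Π≗Π′ i) (Π≗Π′ j)

agreesK? : (S : Subset n) (Π : Partition n) → Dec (AgreesK S Π)
agreesK? S Π = all? λ u → all? λ v →
  (u ∈? S) →-dec (v ∈? S) →-dec ¬? (u ≟ᶠ v) →-dec ¬? (Π u ≟ᶠ Π v)

minCutK-exists : (w : Weights n) (S : Subset n) → Σ ℚ (IsMinCutK w S)
minCutK-exists {n} w S = cut w best ,
  -- The default of `argmin` is the identity labelling: all parts are singletons, so it agrees with
  -- every terminal set.
  (best , argmin-all (cut w) {P = AgreesK S} (λ _ _ _ _ u≢v → u≢v) (all-filter (agreesK? S) partitions) , refl) ,
  λ Π agrees → subst (cut w best ≤ℚ_) (cut-cong w (finToFun-funToFin Π))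
    (All.lookup (f[argmin]≤f[xs] {f = cut w} id candidates)
      -- The candidate compared with is the decoded copy of `Π`, so agreement is transported along
      -- the pointwise equality.
      (∈-filter⁺ (agreesK? S) (∈-map⁺ finToFun (∈-allFin (funToFin Π)))
        λ u v u∈ v∈ u≢v eq → agrees u v u∈ v∈ u≢v
          (trans (sym (finToFun-funToFin Π u)) (trans eq (finToFun-funToFin Π v)))))
  where
  partitions candidates : List (Partition n)
  partitions = map finToFun (allFin (n ^ n))
  candidates = filter (agreesK? S) partitions
  best : Partition n
  best = argmin (cut w) id candidates

minCutK-unique : (w : Weights n) {S : Subset n} {p q : ℚ} → IsMinCutK w S p → IsMinCutK w S q → p ≡ q
minCutK-unique w ((Π , agΠ , refl) , minΠ) ((Π′ , agΠ′ , refl) , minΠ′) = ℚ.≤-antisym (minΠ Π′ agΠ′) (minΠ′ Π agΠ)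

enumKValues : (w : Weights n) (k : ℕ) → Σ (List ℚ) (EnumKValues w k)
enumKValues {n} w k = deduplicate ℚ._≟_ values , deduplicate-! values , λ q → mk⇔ sound complete
  where
  minCutK : Subset n → ℚ
  minCutK = proj₁ ∘ minCutK-exists w
  values : List ℚ
  values = map minCutK (subsetsOfSize n k)
  sound : ∀ {q} → q ∈ₗ deduplicate ℚ._≟_ values → IsKValue w k q
  sound q∈ =
    let S , S∈ , q≡ = ∈-map⁻ minCutK (∈-deduplicate⁻ ℚ._≟_ values q∈)
    in S , ∈-subsetsOfSize⁻ k S∈ , subst (IsMinCutK w S) (sym q≡) (proj₂ (minCutK-exists w S))
  complete : ∀ {q} → IsKValue w k q → q ∈ₗ deduplicate ℚ._≟_ values
  -- The given value may come from another optimal partition, but the minimum for `S` is unique.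
  complete (S , size , isMin) = ∈-deduplicate⁺ ℚ._≟_
    (subst (_∈ₗ values) (minCutK-unique w (proj₂ (minCutK-exists w S)) isMin) (∈-map⁺ minCutK (∈-subsetsOfSize⁺ k size)))

-- Estimates for binomial coefficients

-- C(m, j+1) · (j+1) = C(m, j) · (m - j), without the subtraction.
C-absorb : ∀ m j → suc j * (m C suc j) + j * (m C j) ≡ m * (m C j)
C-absorb zero    zero    = refl
C-absorb zero    (suc j) = cong₂ _+_ (ℕ.*-zeroʳ (suc (suc j))) (ℕ.*-zeroʳ (suc j))
C-absorb (suc m) zero    = trans (ℕ.+-identityʳ _) (trans (ℕ.*-identityˡ _) (trans (nC1≡n (suc m)) (sym (ℕ.*-identityʳ _))))
C-absorb (suc m) (suc j) = begin
  suc (suc j) * (suc m C suc (suc j)) + suc j * (suc m C suc j)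
    ≡⟨ cong₂ (λ x y → suc (suc j) * x + suc j * y)
         (sym (nCk+nC[k+1]≡[n+1]C[k+1] m (suc j))) (sym (nCk+nC[k+1]≡[n+1]C[k+1] m j)) ⟩
  suc (suc j) * (b + c) + suc j * (a + b)
    -- After Pascal's rule the terms are grouped so that the first two brackets are the claim at
    -- `m`, for `suc j` and for `j`.
    ≡⟨ solve 4 (λ j a b c → (con 2 :+ j) :* (b :+ c) :+ (con 1 :+ j) :* (a :+ b)
         := ((con 2 :+ j) :* c :+ (con 1 :+ j) :* b) :+ ((con 1 :+ j) :* b :+ j :* a) :+ (a :+ b)) refl j a b c ⟩
  (suc (suc j) * c + suc j * b) + (suc j * b + j * a) + (a + b)
    ≡⟨ cong₂ (λ x y → x + y + (a + b)) (C-absorb m (suc j)) (C-absorb m j) ⟩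
  m * b + m * a + (a + b)
    ≡⟨ solve 3 (λ m a b → m :* b :+ m :* a :+ (a :+ b) := (con 1 :+ m) :* (a :+ b)) refl m a b ⟩
  suc m * (a + b)
    ≡⟨ cong (suc m *_) (nCk+nC[k+1]≡[n+1]C[k+1] m j) ⟩
  suc m * (suc m C suc j) ∎
  where
  open ≡-Reasoning
  open +-*-Solver
  a = m C j
  b = m C suc j
  c = m C suc (suc j)

-- The hypothesis says that `m` minus `j` is at least half of `n`, and this difference is the factor
-- in `C-absorb`. Adding `2 * j * (m C j)` to both sides avoids subtraction.
C-growth : ∀ n m j → n + 2 * j ≤ 2 * m → n * (m C j) ≤ 2 * suc j * (m C suc j)
C-growth n m j le = ℕ.+-cancelʳ-≤ (2 * j * (m C j)) _ _ (begin
  n * (m C j) + 2 * j * (m C j)                   ≡⟨ ℕ.*-distribʳ-+ (m C j) n (2 * j) ⟨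
  (n + 2 * j) * (m C j)                           ≤⟨ ℕ.*-monoˡ-≤ (m C j) le ⟩
  2 * m * (m C j)                                 ≡⟨ ℕ.*-assoc 2 m (m C j) ⟩
  2 * (m * (m C j))                               ≡⟨ cong (2 *_) (C-absorb m j) ⟨
  2 * (suc j * (m C suc j) + j * (m C j))         ≡⟨ ℕ.*-distribˡ-+ 2 (suc j * (m C suc j)) (j * (m C j)) ⟩
  2 * (suc j * (m C suc j)) + 2 * (j * (m C j))   ≡⟨ cong₂ _+_ (ℕ.*-assoc 2 (suc j) (m C suc j)) (ℕ.*-assoc 2 j (m C j)) ⟨
  2 * suc j * (m C suc j) + 2 * j * (m C j)       ∎)
  where open ≤-Reasoning

C≤^ : ∀ n j → n C j ≤ n ^ j
C≤^ n       zero    = ≤-refl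
C≤^ zero    (suc j) = z≤n
C≤^ (suc n) (suc j) = begin
  suc n C suc j          ≡⟨ nCk+nC[k+1]≡[n+1]C[k+1] n j ⟨
  -- The induction hypotheses add up to `n ^ j + n * n ^ j`, which is the next term by definition.
  n C j + n C suc j      ≤⟨ ℕ.+-mono-≤ (C≤^ n j) (C≤^ n (suc j)) ⟩
  suc n * n ^ j          ≤⟨ ℕ.*-monoʳ-≤ (suc n) (ℕ.^-monoˡ-≤ j (n≤1+n n)) ⟩
  suc n * suc n ^ j      ∎
  where open ≤-Reasoning

-- evenFactorial j = 2^j · j!
evenFactorial : ℕ → ℕ
evenFactorial zero    = 1
evenFactorial (suc j) = evenFactorial j * (2 * suc j)

-- Iterates `C-growth`, whose factors multiply to `evenFactorial j`. The bound has `suc m` instead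
-- of `m` because the last application is at index `j` minus one.
^≤C : ∀ n m j → n + 2 * j ≤ 2 * suc m → n ^ j ≤ evenFactorial j * (m C j)
^≤C n m zero    le = ≤-refl
^≤C n m (suc j) le = begin
  n * n ^ j                                ≤⟨ ℕ.*-monoʳ-≤ n (^≤C n m j (≤-trans (ℕ.+-monoʳ-≤ n (ℕ.*-monoʳ-≤ 2 (n≤1+n j))) le)) ⟩
  n * (D * (m C j))                        ≡⟨ x∙yz≈y∙xz n D (m C j) ⟩
  D * (n * (m C j))                        ≤⟨ ℕ.*-monoʳ-≤ D (C-growth n m j le′) ⟩
  D * (2 * suc j * (m C suc j))            ≡⟨ ℕ.*-assoc D (2 * suc j) (m C suc j) ⟨
  D * (2 * suc j) * (m C suc j)            ∎
  where
  open ≤-Reasoning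
  open CommutativeSemigroupProperties ℕ.*-commutativeSemigroup using (x∙yz≈y∙xz)
  D = evenFactorial j
  le′ : n + 2 * j ≤ 2 * m
  le′ = ℕ.+-cancelˡ-≤ 2 _ _ (subst₂ _≤_
    (solve 2 (λ n j → n :+ con 2 :* (con 1 :+ j) := con 2 :+ (n :+ con 2 :* j)) refl n j)
    (solve 1 (λ m → con 2 :* (con 1 :+ m) := con 2 :+ con 2 :* m) refl m) le)
    where open +-*-Solver

-- Rational sums and natural numbers as rationals

sumFin-suc : (f : Fin (suc n) → ℚ) → sumFin f ≡ f zero ℚ.+ sumFin (f ∘ suc)
sumFin-suc f = cong (λ xs → f zero ℚ.+ foldr ℚ._+_ 0ℚ xs)
  (trans (map-tabulate suc f) (sym (map-tabulate id (f ∘ suc))))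

sumFin-zero : (f : Fin n → ℚ) → (∀ i → f i ≡ 0ℚ) → sumFin f ≡ 0ℚ
sumFin-zero {zero}  f f≡0 = refl
sumFin-zero {suc n} f f≡0 = trans (sumFin-suc f) (cong₂ ℚ._+_ (f≡0 zero) (sumFin-zero (f ∘ suc) (f≡0 ∘ suc)))

sumFin-mono : (f g : Fin n → ℚ) → (∀ i → f i ≤ℚ g i) → sumFin f ≤ℚ sumFin g
sumFin-mono {zero}  f g f≤g = ℚ.≤-refl
sumFin-mono {suc n} f g f≤g = subst₂ _≤ℚ_ (sym (sumFin-suc f)) (sym (sumFin-suc g))
  (ℚ.+-mono-≤ (f≤g zero) (sumFin-mono (f ∘ suc) (g ∘ suc) (f≤g ∘ suc)))

-- Unary recursion lets additivity, positivity and injectivity go by induction.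
fromℕ : ℕ → ℚ
fromℕ zero    = 0ℚ
fromℕ (suc n) = 1ℚ ℚ.+ fromℕ n

fromℕ-+ : ∀ m n → fromℕ (m + n) ≡ fromℕ m ℚ.+ fromℕ n
fromℕ-+ zero    n = sym (ℚ.+-identityˡ _)
fromℕ-+ (suc m) n = trans (cong (1ℚ ℚ.+_) (fromℕ-+ m n)) (sym (ℚ.+-assoc 1ℚ (fromℕ m) (fromℕ n)))

0≤fromℕ : ∀ n → 0ℚ ≤ℚ fromℕ n
0≤fromℕ zero    = ℚ.≤-refl
0≤fromℕ (suc n) = ℚ.+-mono-≤ (ℚ.<⇒≤ (ℚ.positive⁻¹ 1ℚ)) (0≤fromℕ n)

0<fromℕ : ∀ n → 0ℚ <ℚ fromℕ (suc n)
0<fromℕ n = ℚ.+-mono-<-≤ (ℚ.positive⁻¹ 1ℚ) (0≤fromℕ n)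

fromℕ-injective : ∀ m n → fromℕ m ≡ fromℕ n → m ≡ n
fromℕ-injective zero    zero    eq = refl
fromℕ-injective zero    (suc n) eq = contradiction eq (ℚ.<⇒≢ (0<fromℕ n))
fromℕ-injective (suc m) zero    eq = contradiction (sym eq) (ℚ.<⇒≢ (0<fromℕ m))
fromℕ-injective (suc m) (suc n) eq = cong suc (fromℕ-injective m n (+ℚ-cancelˡ 1ℚ _ _ eq))

-- The star with binary weights

star : ∀ m → Weights (suc m)
star m zero    zero    = 0ℚ
star m zero    (suc j) = fromℕ (2 ^ toℕ j)
star m (suc i) zero    = fromℕ (2 ^ toℕ i)
star m (suc i) (suc j) = 0ℚ

star-valid : ∀ m → ValidGraph (star m)
star-valid m = symmetric , nonnegative
  where
  symmetric : ∀ i j → star m i j ≡ star m j i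
  symmetric zero    zero    = refl
  symmetric zero    (suc j) = refl
  symmetric (suc i) zero    = refl
  symmetric (suc i) (suc j) = refl
  nonnegative : ∀ i j → 0ℚ ≤ℚ star m i j
  nonnegative zero    zero    = ℚ.≤-refl
  nonnegative zero    (suc j) = 0≤fromℕ (2 ^ toℕ j)
  nonnegative (suc i) zero    = 0≤fromℕ (2 ^ toℕ i)
  nonnegative (suc i) (suc j) = ℚ.≤-refl

-- Each edge is counted in the row of its smaller endpoint, and the centre is the smallest vertex,
-- so only its row contributes.
cut-star : (Π : Partition (suc m)) →
  cut (star m) Π ≡ sumFin λ j → if not ⌊ Π zero ≟ᶠ Π (suc j) ⌋ then fromℕ (2 ^ toℕ j) else 0ℚ
cut-star {m} Π = begin
  sumFin row                                                ≡⟨ sumFin-suc row ⟩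
  sumFin (entry zero) ℚ.+ sumFin (row ∘ suc)                ≡⟨ cong₂ ℚ._+_ (sumFin-suc (entry zero))
                                                                 (sumFin-zero (row ∘ suc) λ i → sumFin-zero (entry (suc i)) (leaf i)) ⟩
  0ℚ ℚ.+ sumFin (entry zero ∘ suc) ℚ.+ 0ℚ                   ≡⟨ ℚ.+-identityʳ (0ℚ ℚ.+ sumFin (entry zero ∘ suc)) ⟩
  0ℚ ℚ.+ sumFin (entry zero ∘ suc)                          ≡⟨ ℚ.+-identityˡ (sumFin (entry zero ∘ suc)) ⟩
  sumFin (entry zero ∘ suc)                                 ∎
  where
  open ≡-Reasoning
  entry : Fin (suc m) → Fin (suc m) → ℚ
  entry i j = if ⌊ i <? j ⌋ ∧ not ⌊ Π i ≟ᶠ Π j ⌋ then star m i j else 0ℚ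
  row : Fin (suc m) → ℚ
  row i = sumFin (entry i)
  leaf : ∀ i j → entry (suc i) j ≡ 0ℚ
  -- The test `suc i <? zero` fails, so the edge to the centre is not counted a second time.
  leaf i zero    = refl
  leaf i (suc j) = if-eta (⌊ suc i <? suc j ⌋ ∧ not ⌊ Π (suc i) ≟ᶠ Π (suc j) ⌋)

-- The indicator vector read as a binary number, lowest digit first; distinct subset sums thus
-- become uniqueness of binary expansions.
binary : Subset m → ℕ
binary []            = 0
binary (inside  ∷ T) = suc (2 * binary T)
binary (outside ∷ T) = 2 * binary T

binary-injective : (T T′ : Subset m) → binary T ≡ binary T′ → T ≡ T′
binary-injective []            []             eq = refl
binary-injective (inside  ∷ T) (inside  ∷ T′) eq =
  cong (inside ∷_) (binary-injective T T′ (ℕ.*-cancelˡ-≡ _ _ 2 (ℕ.suc-injective eq)))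
binary-injective (outside ∷ T) (outside ∷ T′) eq =
  cong (outside ∷_) (binary-injective T T′ (ℕ.*-cancelˡ-≡ _ _ 2 eq))
binary-injective (inside  ∷ T) (outside ∷ T′) eq = contradiction (sym eq) (ℕ.even≢odd (binary T′) (binary T))
binary-injective (outside ∷ T) (inside  ∷ T′) eq = contradiction eq (ℕ.even≢odd (binary T) (binary T′))

-- The scale `c` is there for the induction: passing to the tail doubles all the weights.
sum-binary : (c : ℕ) (T : Subset m) →
  sumFin (λ j → if lookup T j then fromℕ (c * 2 ^ toℕ j) else 0ℚ) ≡ fromℕ (c * binary T)
sum-binary c []      = cong fromℕ (sym (ℕ.*-zeroʳ c))
sum-binary c (s ∷ T) = trans (sumFin-suc (λ j → if lookup (s ∷ T) j then fromℕ (c * 2 ^ toℕ j) else 0ℚ)) (trans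
  (cong (head ℚ.+_) (trans
    (sumFin-cong λ j → cong (λ x → if lookup T j then fromℕ x else 0ℚ) (sym (ℕ.*-assoc c 2 (2 ^ toℕ j))))
    (sum-binary (c * 2) T)))
  (split s))
  where
  head : ℚ
  head = if s then fromℕ (c * 1) else 0ℚ
  split : ∀ s → (if s then fromℕ (c * 1) else 0ℚ) ℚ.+ fromℕ (c * 2 * binary T) ≡ fromℕ (c * binary (s ∷ T))
  split inside  = trans (sym (fromℕ-+ (c * 1) (c * 2 * binary T)))
    (cong fromℕ (trans (cong (c * 1 +_) (ℕ.*-assoc c 2 (binary T))) (sym (ℕ.*-distribˡ-+ c 1 (2 * binary T)))))
  split outside = trans (ℚ.+-identityˡ _) (cong fromℕ (ℕ.*-assoc c 2 (binary T)))

-- The centre is itself a terminal, so an agreeing partition has to cut the edge of every leaf in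
-- `T`, and cutting these edges alone suffices.
minCutK-star : (T : Subset m) → IsMinCutK (star m) (inside ∷ T) (fromℕ (binary T))
minCutK-star {m} T = (Π , Π-agrees , attained) , minimal
  where
  weight : Fin m → ℚ
  weight j = fromℕ (2 ^ toℕ j)

  value : sumFin (λ j → if lookup T j then weight j else 0ℚ) ≡ fromℕ (binary T)
  value = trans
    (sumFin-cong λ j → cong (λ x → if lookup T j then fromℕ x else 0ℚ) (sym (ℕ.*-identityˡ (2 ^ toℕ j))))
    (trans (sum-binary 1 T) (cong fromℕ (ℕ.*-identityˡ (binary T))))

  -- Leaves in `T` become singletons; all other leaves join the part of the centre.
  Π : Partition (suc m)
  Π zero    = zero
  Π (suc j) = if lookup T j then suc j else zero

  Π-fixes : ∀ {u} → u ∈ inside ∷ T → Π u ≡ u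
  Π-fixes {zero}  _          = refl
  Π-fixes {suc j} (there j∈) = cong (λ b → if b then suc j else zero) ([]=⇒lookup j∈)

  Π-agrees : AgreesK (inside ∷ T) Π
  Π-agrees u v u∈ v∈ u≢v eq = u≢v (trans (sym (Π-fixes u∈)) (trans eq (Π-fixes v∈)))

  separated : ∀ j → not ⌊ zero ≟ᶠ Π (suc j) ⌋ ≡ lookup T j
  separated j with lookup T j
  ... | true  = refl
  ... | false = refl

  attained : cut (star m) Π ≡ fromℕ (binary T)
  attained = trans (cut-star Π) (trans
    (sumFin-cong λ j → cong (λ b → if b then weight j else 0ℚ) (separated j)) value)

  minimal : ∀ Π → AgreesK (inside ∷ T) Π → fromℕ (binary T) ≤ℚ cut (star m) Π
  minimal Π agrees = subst₂ _≤ℚ_ value (sym (cut-star Π)) (sumFin-mono _ _ termwise)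
    where
    termwise : ∀ j → (if lookup T j then weight j else 0ℚ) ≤ℚ (if not ⌊ Π zero ≟ᶠ Π (suc j) ⌋ then weight j else 0ℚ)
    termwise j with lookup T j in j∈ | Π zero ≟ᶠ Π (suc j)
    ... | true  | yes eq = contradiction eq (agrees zero (suc j) here (there (lookup⇒[]= j T j∈)) λ ())
    ... | true  | no _   = ℚ.≤-refl
    ... | false | yes _  = ℚ.≤-refl
    ... | false | no _   = 0≤fromℕ (2 ^ toℕ j)

-- Terminal sets containing the centre already give enough values, one for each `j`-set of leaves.
star-values : ∀ m j {L : List ℚ} → EnumKValues (star m) (suc j) L → m C j ≤ length L
star-values m j {L} (_ , enum) = begin
  m C j                                              ≡⟨ length-subsetsOfSize m j ⟨
  length (subsetsOfSize m j)                         ≡⟨ length-map (fromℕ ∘ binary) (subsetsOfSize m j) ⟨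
  length (map (fromℕ ∘ binary) (subsetsOfSize m j))  ≤⟨ Unique-⊆-length unique contained ⟩
  length L                                           ∎
  where
  open ≤-Reasoning
  unique = Unique.map⁺ (λ {T} {T′} eq → binary-injective T T′ (fromℕ-injective _ _ eq)) (subsetsOfSize-unique m j)
  contained : ∀ {q} → q ∈ₗ map (fromℕ ∘ binary) (subsetsOfSize m j) → q ∈ₗ L
  contained q∈ with T , T∈ , refl ← ∈-map⁻ (fromℕ ∘ binary) q∈ =
    Equivalence.from (enum _) (inside ∷ T , cong suc (∈-subsetsOfSize⁻ j T∈) , minCutK-star T)

-- The three bounds

enum-bound : (w : Weights n) (j : ℕ) {L : List ℚ} → EnumKValues w (suc j) L → length L ≤ n C j
enum-bound w j (L! , enum) = values-bound w j L! (All.tabulate (Equivalence.to (enum _)))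

theorem1p3 : (k : ℕ) → 1 ≤ k →
    (Σ ℕ λ C → ∀ n (w : Weights n) → ValidGraph w →
    Σ (List ℚ) λ L → EnumKValues w k L × length L ≤ C * n ^ (k ∸ 1))
    × (Σ ℕ λ D → Σ ℕ λ N → ∀ n → N ≤ n → (w : Weights n) → ValidGraph w →
    (L : List ℚ) → EnumKValues w k L → n * length L ≤ D * (n C k))
    × (Σ ℕ λ D → Σ ℕ λ N → ∀ n → N ≤ n → Σ (Weights n) λ w → ValidGraph w ×
    Σ (List ℚ) λ L → EnumKValues w k L × n ^ (k ∸ 1) ≤ D * length L)
-- The constants come from `C≤^`, from `C-growth` with `m` equal to `n`, and from `^≤C` with `m`
-- leaves on `suc m` vertices.
theorem1p3 (suc j) _ = (1 , upper) , (2 * suc j , 2 * j , redundancy) , (evenFactorial j , suc (2 * j) , tight)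
  where
  upper : ∀ n (w : Weights n) → ValidGraph w →
    Σ (List ℚ) λ L → EnumKValues w (suc j) L × length L ≤ 1 * n ^ j
  upper n w _ = let L , enum = enumKValues w (suc j) in
    L , enum , ℕ.≤-trans (enum-bound w j enum) (ℕ.≤-trans (C≤^ n j) (ℕ.≤-reflexive (sym (ℕ.*-identityˡ (n ^ j)))))

  -- There are `n C suc j` instances, so with denominators cleared this bounds the redundancy factor
  -- below by `n` over `2 * suc j`.
  redundancy : ∀ n → 2 * j ≤ n → (w : Weights n) → ValidGraph w →
    (L : List ℚ) → EnumKValues w (suc j) L → n * length L ≤ 2 * suc j * (n C suc j)
  redundancy n 2j≤n w _ L enum = ℕ.≤-trans (ℕ.*-monoʳ-≤ n (enum-bound w j enum))
    (C-growth n n j (ℕ.+-monoʳ-≤ n (ℕ.≤-trans 2j≤n (ℕ.m≤m+n n 0))))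

  tight : ∀ n → suc (2 * j) ≤ n → Σ (Weights n) λ w → ValidGraph w ×
    Σ (List ℚ) λ L → EnumKValues w (suc j) L × n ^ j ≤ evenFactorial j * length L
  -- The threshold `suc (2 * j)` reserves one vertex for the centre and leaves at least `2 * j`
  -- leaves.
  tight (suc m) (s≤s 2j≤m) = let L , enum = enumKValues (star m) (suc j) in
    star m , star-valid m , L , enum , ℕ.≤-trans
      (^≤C (suc m) m j (ℕ.+-monoʳ-≤ (suc m) (ℕ.≤-trans 2j≤m (ℕ.≤-trans (ℕ.n≤1+n m) (ℕ.m≤m+n (suc m) 0)))))
      (ℕ.*-monoʳ-≤ (evenFactorial j) (star-values m j enum))
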